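{- Let $n$ be a non-negative integer, let $a,b$ be integers with $\gcd(a,b)=1$, $a+b\neq 0$ and $a+b\neq\pm1$, and let $m$ be a natural number with $m>2$. Put $B(N,m,a,b)=\sum_{k=0}^{N}\binom{N}{k}^m a^{N-k}b^k$. Then $$\omega_{a+b}\big(B(2n,m,a,b)\big)\ge \omega_{a+b}\Big(\binom{2n}{n}\Big),\qquad \omega_{a+b}\big(B(2n+1,m,a,b)\big)\ge 1+\omega_{a+b}\Big((2n+1)\binom{2n}{n}\Big).$$
   Context: For an integer $x$ with $x\neq 0$ and $x\neq\pm1$ and an integer $y$, $\omega_x(y)$ denotes the largest non-negative integer $e$ such that $x^e$ divides $y$ (with the convention $\omega_x(0)=\infty$). Equivalently, the claim says that $(a+b)^{\omega_{a+b}(\binom{2n}{n})}$ divides $B(2n,m,a,b)$ and $(a+b)^{1+\omega_{a+b}((2n+1)\binom{2n}{n})}$ divides $B(2n+1,m,a,b)$. -}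

module Defs where

open import Data.Bool.Base using (if_then_else_)
open import Data.Fin.Base using (toℕ)
open import Data.Integer.Base using (ℤ; +_; 0ℤ; ∣_∣; _*_; _^_)
open import Data.Integer.Divisibility.Signed using (_∣_; _∣?_; divides; ∣⇒∣ᵤ)
open import Data.Integer.Properties using (_≟_; +-*-semiring; abs-*; ∣i∣≡0⇒i≡0; *-identityʳ)
open import Data.Nat.Base as ℕ using (ℕ; zero; suc; z≤n; s≤s)
open import Data.Nat.Combinatorics using (_C_)
import Data.Nat.Divisibility as ℕ
import Data.Nat.Properties as ℕ
open import Data.Product.Base using (∃; _×_; _,_)
open import Function.Base using (_∘_)
open import Relation.Binary.PropositionalEquality using (_≡_; _≢_; refl; sym; trans; cong; subst)
open import Relation.Nullary.Construct.Add.Supremum using (_⁺; ⊤⁺; [_])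
open import Relation.Nullary.Decidable.Core using (does; yes; no)
open import Relation.Nullary.Negation using (contradiction)
open import Relation.Unary using (Pred; Decidable)

open import Relation.Binary.Construct.Add.Supremum.NonStrict ℕ._≤_ public
  using (_≤⁺_; _≤⊤⁺)
  renaming ([_] to [_]≤)

infix 4 _≥⁺_

_≥⁺_ : ℕ ⁺ → ℕ ⁺ → Set
k ≥⁺ l = l ≤⁺ k

1+⁺_ : ℕ ⁺ → ℕ ⁺
1+⁺ [ k ] = [ suc k ]
1+⁺ ⊤⁺    = ⊤⁺

B : ℕ → ℕ → ℤ → ℤ → ℤ
B N m a b = ∑[ k ≤ N ] ((+ (N C toℕ k)) ^ m * a ^ (N ℕ.∸ toℕ k) * b ^ toℕ k)
  where open import Algebra.Properties.Semiring.Sum +-*-semiring using (sum⁺-syntax)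

-- The largest e ≤ n satisfying P; the value is 0 when there is none.
largest≤ : ∀ {p} {P : Pred ℕ p} → Decidable P → ℕ → ℕ
largest≤ P? zero    = zero
largest≤ P? (suc n) = if does (P? (suc n)) then suc n else largest≤ P? n

-- The search may stop at ∣ y ∣: when ∣ x ∣ > 1 and y ≢ 0, x ^ e ∣ y forces
-- e < ∣ x ^ e ∣ ≤ ∣ y ∣.  So ω x y is the multiplicity of x in y for every x
-- other than 0 and ±1 (see ω-finite).  For x = ±1 and y ≢ 0 every e qualifies,
-- there is no largest one, and the value is junk.
ω : ℤ → ℤ → ℕ ⁺
ω x y = if does (y ≟ 0ℤ) then ⊤⁺ else [ largest≤ (λ e → x ^ e ∣? y) ∣ y ∣ ]

∣i^n∣≡∣i∣^n : ∀ i n → ∣ i ^ n ∣ ≡ ∣ i ∣ ℕ.^ n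
∣i^n∣≡∣i∣^n i zero    = refl
∣i^n∣≡∣i∣^n i (suc n) = trans (abs-* i (i ^ n)) (cong (∣ i ∣ ℕ.*_) (∣i^n∣≡∣i∣^n i n))

n<m^n : ∀ {m} n → 1 ℕ.< m → n ℕ.< m ℕ.^ n
n<m^n         zero    1<m = s≤s z≤n
n<m^n {m} (suc n) 1<m = ℕ.≤-<-trans (n<m^n n 1<m) (ℕ.^-monoʳ-< m 1<m (ℕ.n<1+n n))

exponent-bound : ∀ {x y} → 1 ℕ.< ∣ x ∣ → y ≢ 0ℤ → ∀ e → x ^ e ∣ y → e ℕ.≤ ∣ y ∣
exponent-bound {x} {y} 1<∣x∣ y≢0 e x^e∣y =
  ℕ.≤-trans (ℕ.<⇒≤ (n<m^n e 1<∣x∣))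
    (subst (ℕ._≤ ∣ y ∣) (∣i^n∣≡∣i∣^n x e)
      (ℕ.∣⇒≤ {{ℕ.≢-nonZero (y≢0 ∘ ∣i∣≡0⇒i≡0)}} (∣⇒∣ᵤ x^e∣y)))

module _ {p} {P : Pred ℕ p} (P? : Decidable P) where

  largest≤-satisfies : P 0 → ∀ n → P (largest≤ P? n)
  largest≤-satisfies P0 zero    = P0
  largest≤-satisfies P0 (suc n) with P? (suc n)
  ... | yes Pn = Pn
  ... | no  _  = largest≤-satisfies P0 n

  largest≤-upper : ∀ {e n} → e ℕ.≤ n → P e → e ℕ.≤ largest≤ P? n
  largest≤-upper {n = zero}  e≤n Pe = e≤n
  largest≤-upper {n = suc n} e≤n Pe with P? (suc n)
  ... | yes _  = e≤n
  ... | no ¬Pn = largest≤-upper (ℕ.≤-pred (ℕ.≤∧≢⇒< e≤n λ { refl → ¬Pn Pe })) Pe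

ω-infinite : ∀ x → ω x 0ℤ ≡ ⊤⁺
ω-infinite x = refl

ω-finite : ∀ {x y} → 1 ℕ.< ∣ x ∣ → y ≢ 0ℤ →
           ∃ λ e → ω x y ≡ [ e ] × x ^ e ∣ y × (∀ f → x ^ f ∣ y → f ℕ.≤ e)
ω-finite {x} {y} 1<∣x∣ y≢0 with y ≟ 0ℤ
... | yes y≡0 = contradiction y≡0 y≢0
... | no _    = _ , refl
  , largest≤-satisfies x^?∣y (divides y (sym (*-identityʳ y))) ∣ y ∣
  , λ f x^f∣y → largest≤-upper x^?∣y (exponent-bound 1<∣x∣ y≢0 f x^f∣y) x^f∣y
  where
  x^?∣y : Decidable (λ e → x ^ e ∣ y)
  x^?∣y e = x ^ e ∣? y

{-# OPTIONS --safe #-}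

-- Write q = a + b and consider the sums (a b)^s q^(N-2s) for 2s ≤ N.  Multiplying the terms
-- of such a sum, expanded by the binomial theorem, by C(N, k) gives, by Vandermonde, an
-- integral combination of sums of the same kind.  Iterating, it suffices to treat the
-- first step, in which the coefficient of (a b)^s q^d, where N = 2s + d, is a multiple of
-- γ = N! / (s! s! d!).  For N = 2n and r = n - s, γ C(2r, r) = C(2n, n) C(n, s)², while for
-- N = 2n + 1, γ (2r + 1) C(2r, r) = (2n + 1) C(2n, n) C(n, s)².  The factor
-- (2r + 1) C(2r, r) divides lcm(1, …, 2r + 1) and hence, up to a factor coprime to q,
-- divides q^(2r).  So the power of q dividing the right-hand side divides γ q^(2r).
module Submission where

-- Finite sums in a semiring.

module Sums where

  open import Algebra.Bundles using (Semiring)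
  import Algebra.Properties.Semiring.Sum as SemiringSum
  open import Data.Fin.Base using (toℕ)
  open import Data.Fin.Properties using (toℕ<n)
  open import Data.Nat.Base using (ℕ; zero; suc; _+_; _<_)
  open import Function.Base using (_∘_)
  open import Level using (0ℓ)

  module FiniteSum (S : Semiring 0ℓ 0ℓ) where
    private module R = Semiring S
    open R using (_≈_; 0#) renaming (Carrier to A; _+_ to _⊕_; _*_ to _⊛_)
    private module Σ = SemiringSum S

    -- Summands are functions on all of `ℕ`, so that one function can be summed over ranges of
    -- different lengths and shifted, as in `∑-split`.
    ∑ : ℕ → (ℕ → A) → A
    ∑ n f = Σ.sum {n} (f ∘ toℕ)

    ∑-cong : ∀ n {f g} → (∀ i → i < n → f i ≈ g i) → ∑ n f ≈ ∑ n g
    ∑-cong n f≈g = Σ.sum-cong-≋ {n} (λ i → f≈g (toℕ i) (toℕ<n i))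

    ∑-zero : ∀ n {f} → (∀ i → i < n → f i ≈ 0#) → ∑ n f ≈ 0#
    ∑-zero n f≈0 = R.trans (∑-cong n f≈0) (Σ.sum-replicate-zero n)

    *-distribˡ-∑ : ∀ n x f → x ⊛ ∑ n f ≈ ∑ n (λ i → x ⊛ f i)
    *-distribˡ-∑ n x f = Σ.*-distribˡ-sum {n} x (f ∘ toℕ)

    *-distribʳ-∑ : ∀ n x f → ∑ n f ⊛ x ≈ ∑ n (λ i → f i ⊛ x)
    *-distribʳ-∑ n x f = Σ.*-distribʳ-sum {n} x (f ∘ toℕ)

    ∑-distrib-+ : ∀ n f g → ∑ n (λ i → f i ⊕ g i) ≈ ∑ n f ⊕ ∑ n g
    ∑-distrib-+ n f g = Σ.∑-distrib-+ {n} (f ∘ toℕ) (g ∘ toℕ)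

    ∑-comm : ∀ m n (f : ℕ → ℕ → A) → ∑ m (λ i → ∑ n (f i)) ≈ ∑ n (λ j → ∑ m (λ i → f i j))
    ∑-comm m n f = Σ.∑-comm {m} {n} (λ i j → f (toℕ i) (toℕ j))

    ∑-split : ∀ m n f → ∑ (m + n) f ≈ ∑ m f ⊕ ∑ n (f ∘ (m +_))
    ∑-split zero    n f = R.sym (R.+-identityˡ _)
    ∑-split (suc m) n f = R.trans (R.+-congˡ (∑-split m n (f ∘ suc))) (R.sym (R.+-assoc _ _ _))

-- Factorials and products of binomial coefficients.

module Naturals where

  open import Data.Nat.Base
  open import Data.Nat.Combinatorics
  open import Data.Nat.Coprimality using (Coprime; coprime-divisor; gcd≡1⇒coprime)
  import Data.Nat.Coprimality as Coprimality
  open import Data.Nat.DivMod using (m/n*n≡m; _/_)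
  open import Data.Nat.Divisibility
  open import Data.Nat.GCD using (gcd; gcd[m,n]∣m; gcd[m,n]∣n)
  open import Data.Nat.Induction using (<-rec)
  open import Data.Nat.Properties
  open import Data.Nat.Tactic.RingSolver using (solve-∀)
  open import Data.Product.Base using (_,_; _×_; ∃)
  open import Data.Sum.Base using (inj₁; inj₂)
  open import Function.Base using (_∘_)
  open import Relation.Binary.PropositionalEquality
  open import Relation.Nullary using (contradiction)
  open Sums.FiniteSum +-*-semiring

  C-factorial : ∀ p q → ((p + q) C p) * (p ! * q !) ≡ (p + q) !
  C-factorial p q = begin
    ((p + q) C p) * (p ! * q !)                 ≡⟨ cong (λ r → ((p + q) C p) * (p ! * r !)) (m+n∸m≡n p q) ⟨
    ((p + q) C p) * (p ! * (p + q ∸ p) !)       ≡⟨ cong (_* (p ! * (p + q ∸ p) !)) (nCk≡n!/k![n-k]! p≤p+q) ⟩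
    (p + q) ! / (p ! * (p + q ∸ p) !) * (p ! * (p + q ∸ p) !)
                                                ≡⟨ m/n*n≡m (k![n∸k]!∣n! p≤p+q) ⟩
    (p + q) !                                   ∎
    where
    open ≡-Reasoning
    p≤p+q = m≤m+n p q
    instance _ = p !* (p + q ∸ p) !≢0

  C-symmetric : ∀ p q → (p + q) C p ≡ (p + q) C q
  C-symmetric p q = trans (nCk≡nC[n∸k] (m≤m+n p q)) (cong ((p + q) C_) (m+n∸m≡n p q))

  nC0≡1 : ∀ n → n C 0 ≡ 1
  nC0≡1 n = trans (nCk≡nC[n∸k] {0} {n} z≤n) (nCn≡1 n)

  -- This and `multinomial′` reach the multinomial coefficient by the two ways of bracketing
  -- `j + u + v`. Comparing them gives `C-revision` without any division.
  multinomial : ∀ j u v → ((j + u + v) C (j + u)) * ((j + u) C j) * (j ! * (u ! * v !)) ≡ (j + u + v) !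
  multinomial j u v = begin
    A * B * (j ! * (u ! * v !))      ≡⟨ shuffle A B (j !) (u !) (v !) ⟩
    A * (B * (j ! * u !) * v !)      ≡⟨ cong (λ x → A * (x * v !)) (C-factorial j u) ⟩
    A * ((j + u) ! * v !)            ≡⟨ C-factorial (j + u) v ⟩
    (j + u + v) !                    ∎
    where
    open ≡-Reasoning
    A = (j + u + v) C (j + u)
    B = (j + u) C j
    shuffle : ∀ a b x y z → a * b * (x * (y * z)) ≡ a * (b * (x * y) * z)
    shuffle = solve-∀

  multinomial′ : ∀ j u v → ((j + (u + v)) C j) * ((u + v) C u) * (j ! * (u ! * v !)) ≡ (j + (u + v)) !
  multinomial′ j u v = begin
    A * B * (j ! * (u ! * v !))      ≡⟨ shuffle A B (j !) (u ! * v !) ⟩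
    A * (j ! * (B * (u ! * v !)))    ≡⟨ cong (λ x → A * (j ! * x)) (C-factorial u v) ⟩
    A * (j ! * (u + v) !)            ≡⟨ C-factorial j (u + v) ⟩
    (j + (u + v)) !                  ∎
    where
    open ≡-Reasoning
    A = (j + (u + v)) C j
    B = (u + v) C u
    shuffle : ∀ a b x y → a * b * (x * y) ≡ a * (x * (b * y))
    shuffle = solve-∀

  private
    C-revision-+ : ∀ j u v → ((j + u + v) C (j + u)) * ((j + u) C j) ≡ ((j + u + v) C j) * ((u + v) C u)
    C-revision-+ j u v = *-cancelʳ-≡ _ _ (j ! * (u ! * v !)) {{d≢0}} (begin
      ((j + u + v) C (j + u)) * ((j + u) C j) * (j ! * (u ! * v !))  ≡⟨ multinomial j u v ⟩
      (j + u + v) !                                                  ≡⟨ cong _! (+-assoc j u v) ⟩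
      (j + (u + v)) !                                                ≡⟨ multinomial′ j u v ⟨
      ((j + (u + v)) C j) * ((u + v) C u) * (j ! * (u ! * v !))
        ≡⟨ cong (λ n → (n C j) * ((u + v) C u) * (j ! * (u ! * v !))) (+-assoc j u v) ⟨
      ((j + u + v) C j) * ((u + v) C u) * (j ! * (u ! * v !))        ∎)
      where
      open ≡-Reasoning
      d≢0 : NonZero (j ! * (u ! * v !))
      d≢0 = m*n≢0 (j !) (u ! * v !) {{j !≢0}} {{u !* v !≢0}}

  C-revision : ∀ n j u → (n C (j + u)) * ((j + u) C j) ≡ (n C j) * ((n ∸ j) C u)
  C-revision n j u with ≤-total (j + u) n
  ... | inj₁ j+u≤n with v , refl ← m≤n⇒∃[o]m+o≡n j+u≤n = begin
    ((j + u + v) C (j + u)) * ((j + u) C j)      ≡⟨ C-revision-+ j u v ⟩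
    ((j + u + v) C j) * ((u + v) C u)            ≡⟨ cong (λ r → ((j + u + v) C j) * (r C u)) (m+n∸m≡n j (u + v)) ⟨
    ((j + u + v) C j) * ((j + (u + v) ∸ j) C u)  ≡⟨ cong (λ r → ((j + u + v) C j) * ((r ∸ j) C u)) (+-assoc j u v) ⟨
    ((j + u + v) C j) * ((j + u + v ∸ j) C u)    ∎
    where open ≡-Reasoning
  C-revision n j u | inj₂ n≤j+u with m≤n⇒m<n∨m≡n n≤j+u
  ... | inj₂ refl = begin
    ((j + u) C (j + u)) * ((j + u) C j)  ≡⟨ cong (_* ((j + u) C j)) (nCn≡1 (j + u)) ⟩
    1 * ((j + u) C j)                    ≡⟨ *-comm 1 ((j + u) C j) ⟩
    ((j + u) C j) * 1                    ≡⟨ cong (((j + u) C j) *_) (nCn≡1 u) ⟨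
    ((j + u) C j) * (u C u)              ≡⟨ cong (λ r → ((j + u) C j) * (r C u)) (m+n∸m≡n j u) ⟨
    ((j + u) C j) * ((j + u ∸ j) C u)    ∎
    where open ≡-Reasoning
  ... | inj₁ n<j+u = trans (cong (_* ((j + u) C j)) (k>n⇒nCk≡0 n<j+u)) (sym (right u n<j+u))
    where
    right : ∀ u → n < j + u → (n C j) * ((n ∸ j) C u) ≡ 0
    -- For `u = 0` the truncated difference `n ∸ j` is not below `u`, so here the first factor has
    -- to vanish.
    right zero      n<j+0 = cong (_* ((n ∸ j) C 0)) (k>n⇒nCk≡0 (subst (n <_) (+-identityʳ j) n<j+0))
    right u@(suc _) n<j+u = trans (cong ((n C j) *_) (k>n⇒nCk≡0 (m<n+o⇒m∸n<o n j n<j+u))) (*-zeroʳ (n C j))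

  -- By `C-revision` both sides are C(n, j + u) times the number of ways to split j + u elements
  -- into j and u, which is symmetric in j and u.
  C-exchange : ∀ n j u → (n C j) * ((n ∸ j) C u) ≡ (n C u) * ((n ∸ u) C j)
  C-exchange n j u = begin
    (n C j) * ((n ∸ j) C u)        ≡⟨ C-revision n j u ⟨
    (n C (j + u)) * ((j + u) C j)  ≡⟨ cong ((n C (j + u)) *_) (C-symmetric j u) ⟩
    (n C (j + u)) * ((j + u) C u)  ≡⟨ cong (λ s → (n C s) * (s C u)) (+-comm j u) ⟩
    (n C (u + j)) * ((u + j) C u)  ≡⟨ C-revision n u j ⟩
    (n C u) * ((n ∸ u) C j)        ∎
    where open ≡-Reasoning

  -- Vandermonde's convolution and the weights `W`.

  ∑-pascal : ∀ n p (f : ℕ → ℕ) →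
    ∑ (suc n) (λ u → (suc p C u) * f u) ≡ ∑ (suc n) (λ u → (p C u) * f u) + ∑ n (λ u → (p C u) * f (suc u))
  ∑-pascal n p f = begin
    (suc p C 0) * f 0 + ∑ n (λ u → (suc p C suc u) * f (suc u))
      ≡⟨ cong₂ (λ x y → x * f 0 + y) (trans (nC0≡1 (suc p)) (sym (nC0≡1 p))) (∑-cong n (λ u _ → split u)) ⟩
    (p C 0) * f 0 + ∑ n (λ u → (p C suc u) * f (suc u) + (p C u) * f (suc u))
      ≡⟨ cong ((p C 0) * f 0 +_) (∑-distrib-+ n (λ u → (p C suc u) * f (suc u)) (λ u → (p C u) * f (suc u))) ⟩
    (p C 0) * f 0 + (∑ n (λ u → (p C suc u) * f (suc u)) + ∑ n (λ u → (p C u) * f (suc u)))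
      ≡⟨ +-assoc ((p C 0) * f 0) _ _ ⟨
    ∑ (suc n) (λ u → (p C u) * f u) + ∑ n (λ u → (p C u) * f (suc u))
      ∎
    where
    open ≡-Reasoning
    split : ∀ u → (suc p C suc u) * f (suc u) ≡ (p C suc u) * f (suc u) + (p C u) * f (suc u)
    split u = trans (cong (_* f (suc u)) (trans (sym (nCk+nC[k+1]≡[n+1]C[k+1] p u)) (+-comm (p C u) (p C suc u))))
                    (*-distribʳ-+ (f (suc u)) (p C suc u) (p C u))

  -- Induction on `p` by Pascal's rule, which shifts `j` in one of the two sums. Terms with u > p
  -- vanish, so every length n > p is allowed; this lets one fixed length serve all `k` in
  -- `C*W-expansion`.
  vandermonde : ∀ {p n} → p < n → ∀ k j → ∑ n (λ u → (p C u) * (k C (j + u))) ≡ (p + k) C (p + j)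
  vandermonde {zero} {suc n} _ k j = begin
    1 * (k C (j + 0)) + ∑ n (λ u → 0 * (k C (j + suc u)))  ≡⟨ cong₂ _+_ (+-identityʳ _) (∑-zero n λ _ _ → refl) ⟩
    (k C (j + 0)) + 0                                      ≡⟨ +-identityʳ _ ⟩
    k C (j + 0)                                            ≡⟨ cong (k C_) (+-identityʳ j) ⟩
    k C j                                                  ∎
    where open ≡-Reasoning
  vandermonde {suc p} {suc n} (s<s p<n) k j = begin
    ∑ (suc n) (λ u → (suc p C u) * (k C (j + u)))
      ≡⟨ ∑-pascal n p (λ u → k C (j + u)) ⟩
    ∑ (suc n) (λ u → (p C u) * (k C (j + u))) + ∑ n (λ u → (p C u) * (k C (j + suc u)))
      ≡⟨ cong₂ _+_ (vandermonde (m<n⇒m<1+n p<n) k j)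
                   (trans (∑-cong n λ u _ → cong (λ r → (p C u) * (k C r)) (+-suc j u))
                          (vandermonde p<n k (suc j))) ⟩
    ((p + k) C (p + j)) + ((p + k) C (p + suc j))
      ≡⟨ cong (λ r → ((p + k) C (p + j)) + ((p + k) C r)) (+-suc p j) ⟩
    ((p + k) C (p + j)) + ((p + k) C suc (p + j))
      ≡⟨ nCk+nC[k+1]≡[n+1]C[k+1] (p + k) (p + j) ⟩
    suc (p + k) C suc (p + j)
      ∎
    where open ≡-Reasoning

  -- W n j k = (n - j)! / (j! (k - j)! (n - j - k)!), so that Σ_k W n j k a^(n-k) b^k is
  -- C(n - j, j) (a b)^j (a + b)^(n-2j) if 2j ≤ n and 0 otherwise, and W n 0 k = C(n, k).
  W : ℕ → ℕ → ℕ → ℕ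
  W n j k = (k C j) * ((n ∸ j) C k)

  -- Put p = n - j. By `C-exchange`, C(p, u) C(p - u, k) = C(p, k) C(p - k, u), so `u` survives only
  -- in C(p - k, u) C(k, j + u), and Vandermonde sums these. The coefficients on the right do not
  -- depend on `k`, which is what allows the sum over `k` to be taken inside later.
  C*W-expansion : ∀ n j k →
    (n C k) * W n j k ≡ ∑ (suc n) (λ u → (n C j) * ((n ∸ j) C u) * W n (j + u) k)
  C*W-expansion n j k = trans closed (sym (begin
    ∑ (suc n) (λ u → (n C j) * (p C u) * W n (j + u) k)
      ≡⟨ ∑-cong (suc n) (λ u _ → term u) ⟩
    ∑ (suc n) (λ u → (n C j) * (p C k) * (((p ∸ k) C u) * (k C (j + u))))
      ≡⟨ *-distribˡ-∑ (suc n) ((n C j) * (p C k)) (λ u → ((p ∸ k) C u) * (k C (j + u))) ⟨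
    (n C j) * (p C k) * ∑ (suc n) (λ u → ((p ∸ k) C u) * (k C (j + u)))
      ≡⟨ cong ((n C j) * (p C k) *_) (vandermonde (s≤s (≤-trans (m∸n≤m p k) (m∸n≤m n j))) k j) ⟩
    (n C j) * (p C k) * ((p ∸ k + k) C (p ∸ k + j))
      ∎))
    where
    open ≡-Reasoning
    p = n ∸ j
    term : ∀ u → (n C j) * (p C u) * W n (j + u) k ≡ (n C j) * (p C k) * (((p ∸ k) C u) * (k C (j + u)))
    term u = begin
      (n C j) * (p C u) * ((k C (j + u)) * ((n ∸ (j + u)) C k))
        ≡⟨ cong (λ r → (n C j) * (p C u) * ((k C (j + u)) * (r C k))) (∸-+-assoc n j u) ⟨
      (n C j) * (p C u) * ((k C (j + u)) * ((p ∸ u) C k))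
        ≡⟨ shuffle (n C j) (p C u) (k C (j + u)) ((p ∸ u) C k) ⟩
      (n C j) * ((p C u) * ((p ∸ u) C k)) * (k C (j + u))
        ≡⟨ cong (λ r → (n C j) * r * (k C (j + u))) (C-exchange p u k) ⟩
      (n C j) * ((p C k) * ((p ∸ k) C u)) * (k C (j + u))
        ≡⟨ shuffle′ (n C j) (p C k) ((p ∸ k) C u) (k C (j + u)) ⟩
      (n C j) * (p C k) * (((p ∸ k) C u) * (k C (j + u)))
        ∎
      where
      shuffle : ∀ a b c d → a * b * (c * d) ≡ a * (b * d) * c
      shuffle = solve-∀
      shuffle′ : ∀ a b c d → a * (b * c) * d ≡ a * b * (c * d)
      shuffle′ = solve-∀
    closed : (n C k) * W n j k ≡ (n C j) * (p C k) * ((p ∸ k + k) C (p ∸ k + j))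
    closed with ≤-<-connex k p
    ... | inj₂ p<k rewrite k>n⇒nCk≡0 p<k | *-zeroʳ (k C j) | *-zeroʳ (n C k) | *-zeroʳ (n C j) = refl
    ... | inj₁ k≤p with ≤-<-connex j k
    ...   | inj₂ k<j rewrite k>n⇒nCk≡0 k<j | k>n⇒nCk≡0 (+-monoʳ-< (p ∸ k) k<j)
                           | *-zeroʳ (n C k) | *-zeroʳ ((n C j) * (p C k)) = refl
    -- With k = j + i, revision gives C(n, k) C(k, j) = C(n, j) C(p, i), and C(p, i) = C(p, p - i),
    -- where p - i = (p - k) + j.
    ...   | inj₁ j≤k with i , refl ← m≤n⇒∃[o]m+o≡n j≤k = begin
      (n C (j + i)) * (((j + i) C j) * (p C (j + i)))     ≡⟨ *-assoc (n C (j + i)) _ _ ⟨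
      (n C (j + i)) * ((j + i) C j) * (p C (j + i))       ≡⟨ cong (_* (p C (j + i))) (C-revision n j i) ⟩
      (n C j) * (p C i) * (p C (j + i))                   ≡⟨ shuffle (n C j) (p C i) (p C (j + i)) ⟩
      (n C j) * (p C (j + i)) * (p C i)                   ≡⟨ cong ((n C j) * (p C (j + i)) *_) sym-i ⟩
      (n C j) * (p C (j + i)) * ((r + (j + i)) C (r + j)) ∎
      where
      r = p ∸ (j + i)
      shuffle : ∀ a b c → a * b * c ≡ a * c * b
      shuffle = solve-∀
      sym-i : p C i ≡ (r + (j + i)) C (r + j)
      sym-i = begin
        p C i                        ≡⟨ cong (_C i) (m∸n+n≡m k≤p) ⟨
        (r + (j + i)) C i            ≡⟨ cong (_C i) (+-assoc r j i) ⟨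
        (r + j + i) C i              ≡⟨ C-symmetric (r + j) i ⟨
        (r + j + i) C (r + j)        ≡⟨ cong (_C (r + j)) (+-assoc r j i) ⟩
        (r + (j + i)) C (r + j)      ∎

  -- Divisibility up to factors coprime to g.

  -- For non-zero `g` this amounts to coprimality of `c` and `g`. In this form it passes to products
  -- at once and can be applied directly to powers of `g`.
  Cancels : ℕ → ℕ → Set
  Cancels g c = ∀ e x → g ^ e ∣ c * x → g ^ e ∣ x

  cancels-1 : ∀ g → Cancels g 1
  cancels-1 g e x = subst (g ^ e ∣_) (*-identityˡ x)

  cancels-* : ∀ {g} c d → Cancels g c → Cancels g d → Cancels g (c * d)
  cancels-* {g} c d c-cancels d-cancels e x =
    d-cancels e x ∘ c-cancels e (d * x) ∘ subst (g ^ e ∣_) (*-assoc c d x)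

  -- Induction on the exponent: coprimality forces one `g` out of `x`, and that `g` is cancelled on
  -- both sides.
  coprime⇒cancels : ∀ {g c} .{{_ : NonZero g}} → Coprime g c → Cancels g c
  coprime⇒cancels         coprime zero    x _ = 1∣ x
  coprime⇒cancels {g} {c} coprime (suc e) x g^1+e∣cx
    with divides-refl y ← coprime-divisor coprime (∣-trans (m∣m*n (g ^ e)) g^1+e∣cx) =
    subst (g ^ suc e ∣_) (*-comm g y) (*-monoʳ-∣ g
      (coprime⇒cancels coprime e y (*-cancelˡ-∣ g (subst (g ^ suc e ∣_) (shuffle c y g) g^1+e∣cx))))
    where
    shuffle : ∀ c y g → c * (y * g) ≡ g * (c * y)
    shuffle = solve-∀

  module _ (g : ℕ) .{{_ : NonZero g}} where

    DividesUpTo : ℕ → ℕ → Set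
    DividesUpTo i n = ∃ λ c → Cancels g c × i ∣ c * g ^ n

    -- Splitting off gcd (1 + i, g), if it is at least 2, at least halves 1 + i.
    1+i-dividesUpTo-i : ∀ i → DividesUpTo (suc i) i
    1+i-dividesUpTo-i = <-rec _ step
      where
      step : ∀ i → (∀ {j} → j < i → DividesUpTo (suc j) j) → DividesUpTo (suc i) i
      step i rec with gcd (suc i) g in gcd≡d | gcd[m,n]∣m (suc i) g | gcd[m,n]∣n (suc i) g
      ... | 0 | divides q 1+i≡q*0 | _ with () ← trans 1+i≡q*0 (*-zeroʳ q)
      ... | 1 | _ | _ = suc i , coprime⇒cancels (Coprimality.sym (gcd≡1⇒coprime gcd≡d)) , m∣m*n (g ^ i)
      ... | d@(2+ _) | divides zero    1+i≡0     | _ with () ← 1+i≡0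
      -- One further factor `g` absorbs `d`, and `j < i` leaves room for it in the exponent.
      ... | d@(2+ _) | divides (suc j) 1+i≡1+j*d | d∣g =
        let c , c-cancels , 1+j∣cg^j = rec j<i in c , c-cancels , (begin
          suc i            ≡⟨ 1+i≡1+j*d ⟩
          suc j * d        ∣⟨ *-pres-∣ 1+j∣cg^j d∣g ⟩
          c * g ^ j * g    ≡⟨ *-assoc c (g ^ j) g ⟩
          c * (g ^ j * g)  ≡⟨ cong (c *_) (*-comm (g ^ j) g) ⟩
          c * g ^ suc j    ∣⟨ *-monoʳ-∣ c (m≤n⇒m^o∣n^o j<i) ⟩
          c * g ^ i        ∎)
        where
        open ∣-Reasoning
        j<i : j < i
        j<i = s<s⁻¹ (subst (suc j <_) (sym 1+i≡1+j*d) (m<m*n (suc j) d (s<s z<s)))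
        m≤n⇒m^o∣n^o : ∀ {m n} → m ≤ n → g ^ m ∣ g ^ n
        m≤n⇒m^o∣n^o {m} m≤n with k , refl ← m≤n⇒∃[o]m+o≡n m≤n =
          subst (g ^ m ∣_) (sym (^-distribˡ-+-* g m k)) (m∣m*n (g ^ k))

    -- A substitute for lcm(1, ..., n + 1). The cofactors are multiplied together, but the powers of
    -- `g` are not: at each step the single power `g ^ suc n` serves both the earlier divisors and
    -- the new one.
    commonMultiple : ∀ n → ∃ λ c → Cancels g c × (∀ i → i ≤ n → suc i ∣ c * g ^ n)
    commonMultiple zero = 1 , cancels-1 g , λ { zero z≤n → ∣-refl }
    commonMultiple (suc n) with commonMultiple n | 1+i-dividesUpTo-i (suc n)
    ... | c , c-cancels , c-multiple | d , d-cancels , 2+n∣d =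
      c * d , cancels-* c d c-cancels d-cancels , multiple
      where
      shuffle : ∀ c d x g → c * x * (d * g) ≡ c * d * (g * x)
      shuffle = solve-∀
      multiple : ∀ i → i ≤ suc n → suc i ∣ c * d * g ^ suc n
      multiple i i≤1+n with m≤n⇒m<n∨m≡n i≤1+n
      ... | inj₁ (s≤s i≤n) = subst (suc i ∣_) (shuffle c d (g ^ n) g) (∣m⇒∣m*n (d * g) (c-multiple i i≤n))
      ... | inj₂ refl = subst (suc i ∣_) (sym (*-assoc c d (g ^ suc n))) (∣n⇒∣m*n c 2+n∣d)

  -- Leibniz's harmonic triangle and divisors of common multiples.

  C-absorption : ∀ n k → suc k * (suc n C suc k) ≡ suc n * (n C k)
  C-absorption n k = begin
    suc k * (suc n C suc k)        ≡⟨ *-comm (suc k) (suc n C suc k) ⟩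
    (suc n C suc k) * suc k        ≡⟨ cong ((suc n C suc k) *_) (nC1≡n (suc k)) ⟨
    (suc n C suc k) * (suc k C 1)  ≡⟨ C-revision (suc n) 1 k ⟩
    (suc n C 1) * (n C k)          ≡⟨ cong (_* (n C k)) (nC1≡n (suc n)) ⟩
    suc n * (n C k)                ∎
    where open ≡-Reasoning

  k≤n⇒nCk≢0 : ∀ {n k} → k ≤ n → NonZero (n C k)
  k≤n⇒nCk≢0 {k = k} k≤n with i , refl ← m≤n⇒∃[o]m+o≡n k≤n =
    m*n≢0⇒m≢0 ((k + i) C k) {{subst NonZero (sym (C-factorial k i)) ((k + i) !≢0)}}

  -- In Leibniz's harmonic triangle, whose entries are 1 / ((n + 1) C(n, k)), each entry is
  -- the difference of its neighbours: 1 / c = 1 / a - 1 / b.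
  leibniz : ∀ n k → let a = suc n * (n C k); b = suc (suc n) * (suc n C k); c = suc (suc n) * (suc n C suc k) in
    a * (b + c) ≡ b * c
  leibniz n k = begin
    a * (b + c)                                    ≡⟨ cong (a *_) (*-distribˡ-+ (2+ n) (suc n C k) (suc n C suc k)) ⟨
    a * (2+ n * ((suc n C k) + (suc n C suc k)))   ≡⟨ cong (λ x → a * (2+ n * x)) (nCk+nC[k+1]≡[n+1]C[k+1] (suc n) k) ⟩
    a * (2+ n * (2+ n C suc k))                    ≡⟨ cong (_* (2+ n * (2+ n C suc k))) (C-absorption n k) ⟨
    suc k * (suc n C suc k) * (2+ n * (2+ n C suc k))
                                                   ≡⟨ shuffle (suc k) (suc n C suc k) (2+ n) (2+ n C suc k) ⟩
    suc k * (2+ n C suc k) * c                     ≡⟨ cong (_* c) (C-absorption (suc n) k) ⟩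
    b * c                                          ∎
    where
    open ≡-Reasoning
    a = suc n * (n C k)
    b = 2+ n * (suc n C k)
    c = 2+ n * (suc n C suc k)
    shuffle : ∀ x y z w → x * y * (z * w) ≡ x * w * (z * y)
    shuffle = solve-∀

  -- Induction on `k` along the harmonic triangle: since 1 / c = 1 / a - 1 / b, the quotient l / c
  -- is the difference of the integers l / a and l / b. The edge k = 0 holds the numbers n + 1
  -- themselves.
  [1+n]*nCk∣commonMultiple : ∀ {l} n k → k ≤ n → (∀ i → i ≤ n → suc i ∣ l) → suc n * (n C k) ∣ l
  [1+n]*nCk∣commonMultiple {l} n zero _ 1+i∣l =
    subst (_∣ l) (sym (trans (cong (suc n *_) (nC0≡1 n)) (*-identityʳ (suc n)))) (1+i∣l n ≤-refl)
  [1+n]*nCk∣commonMultiple {l} (suc n) (suc k) (s≤s k≤n) 1+i∣l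
    with [1+n]*nCk∣commonMultiple n k k≤n (λ i i≤n → 1+i∣l i (m≤n⇒m≤1+n i≤n))
       | [1+n]*nCk∣commonMultiple (suc n) k (m≤n⇒m≤1+n k≤n) 1+i∣l
  -- Here x = l / a and y = l / b. Truncated subtraction is safe, because l + y c = x c is proved
  -- first, after multiplying by the non-zero `b`.
  ... | divides x l≡xa | divides y l≡yb = divides (x ∸ y) (begin
    l                      ≡⟨ m+n∸n≡m l (y * c) ⟨
    l + y * c ∸ y * c      ≡⟨ cong (_∸ y * c) l+yc≡xc ⟩
    x * c ∸ y * c          ≡⟨ *-distribʳ-∸ c x y ⟨
    (x ∸ y) * c            ∎)
    where
    open ≡-Reasoning
    a = suc n * (n C k)
    b = 2+ n * (suc n C k)
    c = 2+ n * (suc n C suc k)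
    b≢0 : NonZero b
    b≢0 = m*n≢0 (2+ n) (suc n C k) {{_}} {{k≤n⇒nCk≢0 (m≤n⇒m≤1+n k≤n)}}
    shuffle : ∀ x b c → x * c * b ≡ x * (b * c)
    shuffle = solve-∀
    shuffle₂ : ∀ l y b c → (l + y * c) * b ≡ l * b + y * b * c
    shuffle₂ = solve-∀
    l+yc≡xc : l + y * c ≡ x * c
    l+yc≡xc = *-cancelʳ-≡ (l + y * c) (x * c) b {{b≢0}} (begin
      (l + y * c) * b      ≡⟨ shuffle₂ l y b c ⟩
      l * b + y * b * c    ≡⟨ cong (λ z → l * b + z * c) l≡yb ⟨
      l * b + l * c        ≡⟨ *-distribˡ-+ l b c ⟨
      l * (b + c)          ≡⟨ cong (_* (b + c)) l≡xa ⟩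
      x * a * (b + c)      ≡⟨ *-assoc x a (b + c) ⟩
      x * (a * (b + c))    ≡⟨ cong (x *_) (leibniz n k) ⟩
      x * (b * c)          ≡⟨ shuffle x b c ⟨
      x * c * b            ∎)

  -- The factor (n + 1) C(n, k) is replaced by its multiple `c * g ^ n`, and then `c` is cancelled.
  absorb-[1+n]*nCk : ∀ g .{{_ : NonZero g}} {n k} e t → k ≤ n →
    g ^ e ∣ suc n * (n C k) * t → g ^ e ∣ g ^ n * t
  absorb-[1+n]*nCk g {n} {k} e t k≤n g^e∣dt with c , c-cancels , multiple ← commonMultiple g n =
    c-cancels e (g ^ n * t) (subst (g ^ e ∣_) (*-assoc c (g ^ n) t)
      (∣-trans g^e∣dt (*-monoˡ-∣ t ([1+n]*nCk∣commonMultiple n k k≤n multiple))))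

  -- The coefficients `γ` and the powers of g that divide them.

  -- The coefficient of (a b)^s (a + b)^d in Σ_k C(n, k)² a^(n-k) b^k, where n = 2 s + d.
  γ : ℕ → ℕ → ℕ
  γ s d = ((s + (s + d)) C s) * ((s + d) C s)

  module _ (s r : ℕ) where
    private
      n = s + r
      M = (n + n) C n
      X = n C s
      D = (r + r) C r
      d! = s ! * s ! * (r ! * r !)
      d!≢0 : NonZero d!
      d!≢0 = m*n≢0 (s ! * s !) (r ! * r !) {{s !* s !≢0}} {{r !* r !≢0}}

      right : M * (X * X) * d! ≡ (n + n) !
      right = begin
        M * (X * X) * d!                              ≡⟨ shuffle M X (s !) (r !) ⟩
        M * (X * (s ! * r !) * (X * (s ! * r !)))     ≡⟨ cong (λ f → M * (f * f)) (C-factorial s r) ⟩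
        M * (n ! * n !)                               ≡⟨ C-factorial n n ⟩
        (n + n) !                                     ∎
        where
        open ≡-Reasoning
        shuffle : ∀ m x s r → m * (x * x) * (s * s * (r * r)) ≡ m * (x * (s * r) * (x * (s * r)))
        shuffle = solve-∀

    -- Multiplication by (s! r!)² turns both sides into (2n)!.
    γ-even : γ s (r + r) * D ≡ M * (X * X)
    γ-even = *-cancelʳ-≡ _ _ d! {{d!≢0}} (begin
      t * D * d!                             ≡⟨ shuffle t D (s !) (r !) ⟩
      t * (s ! * (s ! * (D * (r ! * r !))))  ≡⟨ cong (λ f → t * (s ! * (s ! * f))) (C-factorial r r) ⟩
      t * (s ! * (s ! * (r + r) !))          ≡⟨ multinomial′ s s (r + r) ⟩
      (s + (s + (r + r))) !                  ≡⟨ cong _! (shuffle₂ s r) ⟩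
      (n + n) !                              ≡⟨ right ⟨
      M * (X * X) * d!                       ∎)
      where
      open ≡-Reasoning
      t = γ s (r + r)
      shuffle : ∀ t d s r → t * d * (s * s * (r * r)) ≡ t * (s * (s * (d * (r * r))))
      shuffle = solve-∀
      shuffle₂ : ∀ s r → s + (s + (r + r)) ≡ s + r + (s + r)
      shuffle₂ = solve-∀

    -- The multiplier (s! r!)² from the even case now gives (2n + 1)! on both sides: 2r + 1
    -- completes (2r)! on the left, and 2n + 1 completes (2n)! on the right.
    γ-odd : γ s (suc (r + r)) * (suc (r + r) * D) ≡ suc (n + n) * M * (X * X)
    γ-odd = *-cancelʳ-≡ _ _ d! {{d!≢0}} (begin
      t * (suc (r + r) * D) * d!                ≡⟨ shuffle t (suc (r + r)) D (s !) (r !) ⟩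
      t * (s ! * (s ! * (suc (r + r) * (D * (r ! * r !)))))
        ≡⟨ cong (λ f → t * (s ! * (s ! * (suc (r + r) * f)))) (C-factorial r r) ⟩
      t * (s ! * (s ! * suc (r + r) !))         ≡⟨ multinomial′ s s (suc (r + r)) ⟩
      (s + (s + suc (r + r))) !                 ≡⟨ cong _! (shuffle₂ s r) ⟩
      suc (n + n) !                             ≡⟨ cong (suc (n + n) *_) right ⟨
      suc (n + n) * (M * (X * X) * d!)          ≡⟨ shuffle₃ (suc (n + n)) M (X * X) d! ⟩
      suc (n + n) * M * (X * X) * d!            ∎)
      where
      open ≡-Reasoning
      t = γ s (suc (r + r))
      shuffle : ∀ t q d s r → t * (q * d) * (s * s * (r * r)) ≡ t * (s * (s * (q * (d * (r * r)))))
      shuffle = solve-∀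
      shuffle₂ : ∀ s r → s + (s + suc (r + r)) ≡ suc (s + r + (s + r))
      shuffle₂ = solve-∀
      shuffle₃ : ∀ a b c d → a * (b * c * d) ≡ a * b * c * d
      shuffle₃ = solve-∀

  halve-even : ∀ {s d n} → s + (s + d) ≡ n + n → ∃ λ r → n ≡ s + r × d ≡ r + r
  halve-even {s} {d} {n} 2s+d≡2n with ≤-<-connex s n
  ... | inj₂ n<s = contradiction (m+n≤o⇒m≤o (s + s) (≤-reflexive (trans (+-assoc s s d) 2s+d≡2n)))
                                (<⇒≱ (+-mono-< n<s n<s))
  ... | inj₁ s≤n with r , refl ← m≤n⇒∃[o]m+o≡n s≤n =
    r , refl , +-cancelˡ-≡ (s + s) d (r + r) (trans (+-assoc s s d) (trans 2s+d≡2n (shuffle s r)))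
    where
    shuffle : ∀ s r → s + r + (s + r) ≡ s + s + (r + r)
    shuffle = solve-∀

  s+[s+1+d]≡1+s+[s+d] : ∀ s d → s + (s + suc d) ≡ suc (s + (s + d))
  s+[s+1+d]≡1+s+[s+d] = solve-∀

  halve-odd : ∀ {s d n} → s + (s + d) ≡ suc (n + n) → ∃ λ r → n ≡ s + r × d ≡ suc (r + r)
  halve-odd {s} {zero} {n} 2s≡1+2n = contradiction (trans (sym (shuffle s)) (trans 2s≡1+2n (shuffle₂ n))) (even≢odd s n)
    where
    shuffle : ∀ s → s + (s + 0) ≡ 2 * s
    shuffle = solve-∀
    shuffle₂ : ∀ n → suc (n + n) ≡ suc (2 * n)
    shuffle₂ = solve-∀
  halve-odd {s} {suc d} {n} 2s+d≡2n
    with r , n≡s+r , refl ← halve-even {s} {d} {n} (suc-injective (trans (sym (s+[s+1+d]≡1+s+[s+d] s d)) 2s+d≡2n)) = r , n≡s+r , refl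

  module _ (g : ℕ) .{{_ : NonZero g}} (e n : ℕ) where

    γ-even-∣ : g ^ e ∣ (n + n) C n → ∀ s d → s + (s + d) ≡ n + n → g ^ e ∣ g ^ d * γ s d
    γ-even-∣ g^e∣M s d 2s+d≡2n with r , refl , refl ← halve-even {s} {d} {n} 2s+d≡2n =
      absorb-[1+n]*nCk g e (γ s d) (m≤m+n r r) (begin
        g ^ e                             ∣⟨ ∣m⇒∣m*n _ g^e∣M ⟩
        ((n + n) C n) * ((n C s) * (n C s))
                                          ≡⟨ γ-even s r ⟨
        -- The factor 2r + 1 is inserted because absorption concerns (2r + 1) C(2r, r) as a whole.
        γ s d * (d C r)                   ∣⟨ n∣m*n (suc d) ⟩
        suc d * (γ s d * (d C r))         ≡⟨ shuffle (suc d) (γ s d) (d C r) ⟩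
        suc d * (d C r) * γ s d           ∎)
      where
      open ∣-Reasoning
      shuffle : ∀ a t c → a * (t * c) ≡ a * c * t
      shuffle = solve-∀

    -- Here d = 2r + 1, while absorbing (2r + 1) C(2r, r) costs only g^(2r). The spare factor `g` is
    -- the source of the 1 added in the odd case.
    γ-odd-∣ : g ^ e ∣ suc (n + n) * ((n + n) C n) → ∀ s d → s + (s + d) ≡ suc (n + n) → g ^ suc e ∣ g ^ d * γ s d
    γ-odd-∣ g^e∣M s d 2s+d≡2n with r , refl , refl ← halve-odd {s} {d} {n} 2s+d≡2n =
      subst (g ^ suc e ∣_) (sym (*-assoc g (g ^ (r + r)) (γ s d)))
      (*-monoʳ-∣ g (absorb-[1+n]*nCk g e (γ s d) (m≤m+n r r) (begin
        g ^ e                             ∣⟨ ∣m⇒∣m*n _ g^e∣M ⟩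
        suc (n + n) * ((n + n) C n) * ((n C s) * (n C s))
                                          ≡⟨ γ-odd s r ⟨
        γ s d * (d * ((r + r) C r))       ≡⟨ *-comm (γ s d) _ ⟩
        d * ((r + r) C r) * γ s d         ∎)))
      where
      open ∣-Reasoning

-- Integer sums with the weights `W`.

module Integers where

  open import Data.Integer.Base using (ℤ; +_; 0ℤ; -[1+_]; _+_; _*_; _^_; ∣_∣)
  open import Data.Integer.Divisibility.Signed
  open import Data.Integer.Properties
  open import Data.Integer.Tactic.RingSolver using (solve-∀)
  open import Data.Nat.Base as ℕ using (ℕ; zero; suc; _∸_; _<_; s≤s)
  open import Data.Nat.Combinatorics using (_C_; k>n⇒nCk≡0)
  import Data.Nat.Divisibility as ℕ
  import Data.Nat.Properties as ℕ
  open import Data.Product.Base using (_,_; _×_)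
  open import Data.Sum.Base using (inj₁; inj₂)
  open import Function.Base using (_∘_)
  open import Relation.Binary.PropositionalEquality
  open import Relation.Nullary using (Dec; yes; no; contradiction)
  open import Relation.Nullary.Construct.Add.Supremum using ([_])
  import Algebra.Properties.CommutativeSemiring.Binomial +-*-commutativeSemiring as Binomial
  import Algebra.Properties.Semiring.Mult +-*-semiring as Mult
  import Algebra.Properties.Semiring.Exp +-*-semiring as Exp
  open import Defs
  open Naturals
  open Sums.FiniteSum +-*-semiring
  private module ℕΣ = Sums.FiniteSum ℕ.+-*-semiring

  ^≡^ : ∀ x n → x Exp.^ n ≡ x ^ n
  ^≡^ x zero    = refl
  ^≡^ x (suc n) = cong (x *_) (^≡^ x n)

  ×≡* : ∀ n x → n Mult.× x ≡ + n * x
  ×≡* zero    x = sym (*-zeroˡ x)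
  ×≡* (suc n) x = trans (cong (_+_ x) (×≡* n x)) (sym (suc-* (+ n) x))

  binomial : ∀ n a b → ∑ (suc n) (λ i → + (n C i) * (a ^ (n ∸ i) * b ^ i)) ≡ (a + b) ^ n
  binomial n a b = begin
    ∑ (suc n) (λ i → + (n C i) * (a ^ (n ∸ i) * b ^ i))
      ≡⟨ ∑-cong (suc n) (λ i _ → sym (trans (×≡* (n C i) _) (cong (+ (n C i) *_)
           (trans (cong₂ _*_ (^≡^ b i) (^≡^ a (n ∸ i))) (*-comm (b ^ i) (a ^ (n ∸ i))))))) ⟩
    -- The expansion lists ascending powers of its first argument, hence `b` before `a`.
    Binomial.binomialExpansion b a n
      ≡⟨ Binomial.theorem n b a ⟨
    (b + a) Exp.^ n
      ≡⟨ ^≡^ (b + a) n ⟩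
    (b + a) ^ n
      ≡⟨ cong (_^ n) (+-comm b a) ⟩
    (a + b) ^ n
      ∎
    where open ≡-Reasoning

  pos-∑ : ∀ n f → + ℕΣ.∑ n f ≡ ∑ n (λ i → + f i)
  pos-∑ zero    f = refl
  pos-∑ (suc n) f = trans (pos-+ (f 0) _) (cong (_+_ (+ f 0)) (pos-∑ n (f ∘ suc)))

  ∣-∑ : ∀ {q} n f → (∀ i → q ∣ f i) → q ∣ ∑ n f
  ∣-∑     zero    f q∣f = divides 0ℤ refl
  ∣-∑ {q} (suc n) f q∣f = ∣m∣n⇒∣m+n (q∣f 0) (∣-∑ n (f ∘ suc) (q∣f ∘ suc))

  -- At j = 0 the weight is C(n, k); the other `j` are the auxiliary sums that appear when a further
  -- factor C(n, k) is expanded.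
  WeightedSum : ℕ → ℕ → (ℕ → ℤ) → ℤ
  WeightedSum n j f = ∑ (suc n) (λ k → + W n j k * f k)

  weightedSum-cong : ∀ n j {f g} → (∀ k → f k ≡ g k) → WeightedSum n j f ≡ WeightedSum n j g
  weightedSum-cong n j f≡g = ∑-cong (suc n) (λ k _ → cong (+ W n j k *_) (f≡g k))

  -- `C*W-expansion` is applied termwise; as its coefficients are free of `k`, the two sums can be
  -- interchanged.
  weightedSum-C* : ∀ n j f → WeightedSum n j (λ k → + (n C k) * f k) ≡
    ∑ (suc n) (λ u → + ((n C j) ℕ.* ((n ∸ j) C u)) * WeightedSum n (j ℕ.+ u) f)
  weightedSum-C* n j f = begin
    ∑ (suc n) (λ k → + W n j k * (+ (n C k) * f k))
      ≡⟨ ∑-cong (suc n) (λ k _ → expand k) ⟩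
    ∑ (suc n) (λ k → ∑ (suc n) (λ u → + c u * (+ W n (j ℕ.+ u) k * f k)))
      ≡⟨ ∑-comm (suc n) (suc n) (λ k u → + c u * (+ W n (j ℕ.+ u) k * f k)) ⟩
    ∑ (suc n) (λ u → ∑ (suc n) (λ k → + c u * (+ W n (j ℕ.+ u) k * f k)))
      ≡⟨ ∑-cong (suc n) (λ u _ → sym (*-distribˡ-∑ (suc n) (+ c u) (λ k → + W n (j ℕ.+ u) k * f k))) ⟩
    ∑ (suc n) (λ u → + c u * WeightedSum n (j ℕ.+ u) f)
      ∎
    where
    open ≡-Reasoning
    c : ℕ → ℕ
    c u = (n C j) ℕ.* ((n ∸ j) C u)
    shuffle : ∀ x y z → x * (y * z) ≡ y * x * z
    shuffle = solve-∀
    expand : ∀ k → + W n j k * (+ (n C k) * f k) ≡ ∑ (suc n) (λ u → + c u * (+ W n (j ℕ.+ u) k * f k))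
    expand k = begin
      + W n j k * (+ (n C k) * f k)      ≡⟨ shuffle (+ W n j k) (+ (n C k)) (f k) ⟩
      + (n C k) * + W n j k * f k        ≡⟨ cong (_* f k) (pos-* (n C k) (W n j k)) ⟨
      + ((n C k) ℕ.* W n j k) * f k      ≡⟨ cong (λ x → + x * f k) (C*W-expansion n j k) ⟩
      + ℕΣ.∑ (suc n) (λ u → c u ℕ.* W n (j ℕ.+ u) k) * f k
                                         ≡⟨ cong (_* f k) (pos-∑ (suc n) (λ u → c u ℕ.* W n (j ℕ.+ u) k)) ⟩
      ∑ (suc n) (λ u → + (c u ℕ.* W n (j ℕ.+ u) k)) * f k
                                         ≡⟨ *-distribʳ-∑ (suc n) (f k) (λ u → + (c u ℕ.* W n (j ℕ.+ u) k)) ⟩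
      ∑ (suc n) (λ u → + (c u ℕ.* W n (j ℕ.+ u) k) * f k)
        ≡⟨ ∑-cong (suc n) (λ u _ → trans (cong (_* f k) (pos-* (c u) (W n (j ℕ.+ u) k))) (*-assoc (+ c u) _ (f k))) ⟩
      ∑ (suc n) (λ u → + c u * (+ W n (j ℕ.+ u) k * f k)) ∎

  module _ (q : ℤ) (n : ℕ) where

    -- All `j` are taken together because expanding at `j` calls on every `j + u`; this makes the
    -- property stable under multiplying `f` by C(n, k).
    DividesWeightedSums : (ℕ → ℤ) → Set
    DividesWeightedSums f = ∀ j → q ∣ WeightedSum n j f

    divides-C* : ∀ {f} → DividesWeightedSums f → DividesWeightedSums (λ k → + (n C k) * f k)
    divides-C* {f} q∣f j = subst (q ∣_) (sym (weightedSum-C* n j f))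
      (∣-∑ (suc n) _ (λ u → ∣n⇒∣m*n (+ ((n C j) ℕ.* ((n ∸ j) C u))) {WeightedSum n (j ℕ.+ u) f} (q∣f (j ℕ.+ u))))

  -- Weighted sums of the monomials a^(n-k) b^k.

  monomial : ℕ → ℤ → ℤ → ℕ → ℤ
  monomial n a b k = a ^ (n ∸ k) * b ^ k

  -- The two factors of W n s k are non-zero only if s ≤ k ≤ n ∸ s.
  weightedSum-base-0 : ∀ n s f → n < s ℕ.+ s → WeightedSum n s f ≡ 0ℤ
  weightedSum-base-0 n s f n<2s = ∑-zero (suc n) (λ k _ → cong (λ w → + w * f k) (W≡0 k))
    where
    n∸s<s : n ∸ s < s
    n∸s<s = ℕ.m<n+o⇒m∸n<o n s {{ℕ.≢-nonZero λ { refl → ℕ.n≮0 n<2s }}} n<2s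
    W≡0 : ∀ k → W n s k ≡ 0
    W≡0 k with ℕ.≤-<-connex s k
    ... | inj₁ s≤k = trans (cong ((k C s) ℕ.*_) (k>n⇒nCk≡0 (ℕ.<-≤-trans n∸s<s s≤k))) (ℕ.*-zeroʳ (k C s))
    ... | inj₂ k<s = cong (ℕ._* ((n ∸ s) C k)) (k>n⇒nCk≡0 k<s)

  -- The n + 1 indices fall into s vanishing, d + 1 contributing and s vanishing ones. At k = s + i
  -- the weight is C(s + d, s) C(d, i), so the middle block is a binomial expansion of (a + b)^d.
  weightedSum-base : ∀ s d a b → let n = s ℕ.+ (s ℕ.+ d) in
    WeightedSum n s (monomial n a b) ≡ + ((s ℕ.+ d) C s) * (a ^ s * b ^ s) * (a + b) ^ d
  weightedSum-base s d a b = begin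
    ∑ (suc n) f
      ≡⟨ cong (λ m → ∑ m f) (size s d) ⟩
    ∑ (s ℕ.+ (suc d ℕ.+ s)) f
      ≡⟨ ∑-split s (suc d ℕ.+ s) f ⟩
    ∑ s f + ∑ (suc d ℕ.+ s) (f ∘ (s ℕ.+_))
      ≡⟨ cong₂ _+_ (∑-zero s low) (∑-split (suc d) s (f ∘ (s ℕ.+_))) ⟩
    0ℤ + (∑ (suc d) (f ∘ (s ℕ.+_)) + ∑ s (λ i → f (s ℕ.+ (suc d ℕ.+ i))))
      ≡⟨ cong (λ x → 0ℤ + (∑ (suc d) (f ∘ (s ℕ.+_)) + x)) (∑-zero s (λ i _ → high i)) ⟩
    0ℤ + (∑ (suc d) (f ∘ (s ℕ.+_)) + 0ℤ)
      ≡⟨ trans (+-identityˡ _) (+-identityʳ _) ⟩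
    ∑ (suc d) (f ∘ (s ℕ.+_))
      ≡⟨ ∑-cong (suc d) middle ⟩
    ∑ (suc d) (λ i → c * (+ (d C i) * (a ^ (d ∸ i) * b ^ i)))
      ≡⟨ *-distribˡ-∑ (suc d) c (λ i → + (d C i) * (a ^ (d ∸ i) * b ^ i)) ⟨
    c * ∑ (suc d) (λ i → + (d C i) * (a ^ (d ∸ i) * b ^ i))
      ≡⟨ cong (c *_) (binomial d a b) ⟩
    c * (a + b) ^ d
      ∎
    where
    open ≡-Reasoning
    n = s ℕ.+ (s ℕ.+ d)
    c = + ((s ℕ.+ d) C s) * (a ^ s * b ^ s)
    f : ℕ → ℤ
    f k = + W n s k * monomial n a b k
    size : ∀ s d → suc (s ℕ.+ (s ℕ.+ d)) ≡ s ℕ.+ (suc d ℕ.+ s)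
    size s d = trans (sym (ℕ.+-suc s (s ℕ.+ d))) (cong (λ x → s ℕ.+ suc x) (ℕ.+-comm s d))
    n∸s : n ∸ s ≡ s ℕ.+ d
    n∸s = ℕ.m+n∸m≡n s (s ℕ.+ d)
    low : ∀ k → k < s → f k ≡ 0ℤ
    low k k<s = cong (λ w → + (w ℕ.* ((n ∸ s) C k)) * monomial n a b k) (k>n⇒nCk≡0 k<s)
    high : ∀ i → f (s ℕ.+ (suc d ℕ.+ i)) ≡ 0ℤ
    high i = cong (λ w → + w * monomial n a b k) (trans (cong ((k C s) ℕ.*_) (k>n⇒nCk≡0 n∸s<k)) (ℕ.*-zeroʳ (k C s)))
      where
      k = s ℕ.+ (suc d ℕ.+ i)
      n∸s<k : n ∸ s < k
      n∸s<k = subst (_< k) (sym n∸s) (ℕ.+-monoʳ-< s (s≤s (ℕ.m≤m+n d i)))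
    weight : ∀ i → W n s (s ℕ.+ i) ≡ ((s ℕ.+ d) C s) ℕ.* (d C i)
    weight i = begin
      ((s ℕ.+ i) C s) ℕ.* ((n ∸ s) C (s ℕ.+ i))    ≡⟨ ℕ.*-comm ((s ℕ.+ i) C s) _ ⟩
      ((n ∸ s) C (s ℕ.+ i)) ℕ.* ((s ℕ.+ i) C s)    ≡⟨ C-revision (n ∸ s) s i ⟩
      ((n ∸ s) C s) ℕ.* ((n ∸ s ∸ s) C i)          ≡⟨ cong (λ r → (r C s) ℕ.* ((r ∸ s) C i)) n∸s ⟩
      ((s ℕ.+ d) C s) ℕ.* ((s ℕ.+ d ∸ s) C i)      ≡⟨ cong (λ r → ((s ℕ.+ d) C s) ℕ.* (r C i)) (ℕ.m+n∸m≡n s d) ⟩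
      ((s ℕ.+ d) C s) ℕ.* (d C i)                  ∎
    middle : ∀ i → i < suc d → f (s ℕ.+ i) ≡ c * (+ (d C i) * (a ^ (d ∸ i) * b ^ i))
    middle i (s≤s i≤d) = begin
      + W n s (s ℕ.+ i) * (a ^ (n ∸ (s ℕ.+ i)) * b ^ (s ℕ.+ i))
        ≡⟨ cong₂ (λ w e → + w * (a ^ e * b ^ (s ℕ.+ i))) (weight i) exponent ⟩
      + (((s ℕ.+ d) C s) ℕ.* (d C i)) * (a ^ (s ℕ.+ (d ∸ i)) * b ^ (s ℕ.+ i))
        ≡⟨ cong₂ _*_ (pos-* ((s ℕ.+ d) C s) (d C i)) (cong₂ _*_ (^-distribˡ-+-* a s (d ∸ i)) (^-distribˡ-+-* b s i)) ⟩
      + ((s ℕ.+ d) C s) * + (d C i) * (a ^ s * a ^ (d ∸ i) * (b ^ s * b ^ i))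
        ≡⟨ shuffle (+ ((s ℕ.+ d) C s)) (+ (d C i)) (a ^ s) (a ^ (d ∸ i)) (b ^ s) (b ^ i) ⟩
      c * (+ (d C i) * (a ^ (d ∸ i) * b ^ i)) ∎
      where
      shuffle : ∀ x y as a bs b → x * y * (as * a * (bs * b)) ≡ x * (as * bs) * (y * (a * b))
      shuffle = solve-∀
      exponent : n ∸ (s ℕ.+ i) ≡ s ℕ.+ (d ∸ i)
      exponent = trans (ℕ.[m+n]∸[m+o]≡n∸o s (s ℕ.+ d) i) (ℕ.+-∸-assoc s i≤d)

  module _ (q : ℤ) (n : ℕ) (a b : ℤ) (q∣γ : ∀ s d → s ℕ.+ (s ℕ.+ d) ≡ n → q ∣ (a + b) ^ d * + γ s d) where

    -- The factor C(n, s) completes the coefficient C(s + d, s) of `weightedSum-base` to `γ s d`;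
    -- for 2s > n the sum is zero.
    q∣C*weightedSum : ∀ s → q ∣ + (n C s) * WeightedSum n s (monomial n a b)
    q∣C*weightedSum s with ℕ.≤-<-connex (s ℕ.+ s) n
    ... | inj₂ n<2s = divides 0ℤ (trans (cong (+ (n C s) *_) (weightedSum-base-0 n s (monomial n a b) n<2s))
                                        (*-zeroʳ (+ (n C s))))
    ... | inj₁ 2s≤n with d , 2s+d≡n ← ℕ.m≤n⇒∃[o]m+o≡n 2s≤n
                    with refl ← trans (sym (ℕ.+-assoc s s d)) 2s+d≡n =
      subst (q ∣_) (sym eq) (∣n⇒∣m*n (a ^ s * b ^ s) (q∣γ s d refl))
      where
      shuffle : ∀ x y z w → x * (y * z * w) ≡ z * (w * (x * y))
      shuffle = solve-∀
      eq : + (n C s) * WeightedSum n s (monomial n a b) ≡ a ^ s * b ^ s * ((a + b) ^ d * + γ s d)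
      eq = trans (cong (+ (n C s) *_) (weightedSum-base s d a b))
           (trans (shuffle (+ (n C s)) (+ ((s ℕ.+ d) C s)) (a ^ s * b ^ s) ((a + b) ^ d))
           (cong (λ x → a ^ s * b ^ s * ((a + b) ^ d * x)) (sym (pos-* (n C s) ((s ℕ.+ d) C s)))))

    -- The induction starts at exponent 1, since the first factor C(n, k) is what produces `γ`: the
    -- coefficient C(n, j) C(n - j, u) equals C(s, j) C(n, s) with s = j + u. Each further factor is
    -- handled by `divides-C*`.
    dividesWeightedSums-C^ : ∀ t → DividesWeightedSums q n (λ k → (+ (n C k)) ^ suc t * monomial n a b k)
    dividesWeightedSums-C^ zero j = subst (q ∣_) (sym expansion) (∣-∑ (suc n) _ (λ u →
      ∣n⇒∣m*n (+ ((j ℕ.+ u) C j)) (q∣C*weightedSum (j ℕ.+ u))))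
      where
      open ≡-Reasoning
      S : ℕ → ℤ
      S s = WeightedSum n s (monomial n a b)
      coefficient : ∀ u → + ((n C j) ℕ.* ((n ∸ j) C u)) * S (j ℕ.+ u) ≡
                          + ((j ℕ.+ u) C j) * (+ (n C (j ℕ.+ u)) * S (j ℕ.+ u))
      coefficient u = begin
        + ((n C j) ℕ.* ((n ∸ j) C u)) * S s    ≡⟨ cong (λ x → + x * S s) (C-revision n j u) ⟨
        + ((n C s) ℕ.* (s C j)) * S s          ≡⟨ cong (λ x → + x * S s) (ℕ.*-comm (n C s) (s C j)) ⟩
        + ((s C j) ℕ.* (n C s)) * S s          ≡⟨ cong (_* S s) (pos-* (s C j) (n C s)) ⟩
        + (s C j) * + (n C s) * S s            ≡⟨ *-assoc (+ (s C j)) (+ (n C s)) (S s) ⟩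
        + (s C j) * (+ (n C s) * S s)          ∎
        where s = j ℕ.+ u
      expansion : WeightedSum n j (λ k → (+ (n C k)) ^ 1 * monomial n a b k) ≡
                  ∑ (suc n) (λ u → + ((j ℕ.+ u) C j) * (+ (n C (j ℕ.+ u)) * S (j ℕ.+ u)))
      expansion = begin
        WeightedSum n j (λ k → (+ (n C k)) ^ 1 * monomial n a b k)
          ≡⟨ weightedSum-cong n j (λ k → cong (_* monomial n a b k) (*-identityʳ (+ (n C k)))) ⟩
        WeightedSum n j (λ k → + (n C k) * monomial n a b k)
          ≡⟨ weightedSum-C* n j (monomial n a b) ⟩
        ∑ (suc n) (λ u → + ((n C j) ℕ.* ((n ∸ j) C u)) * S (j ℕ.+ u))
          ≡⟨ ∑-cong (suc n) (λ u _ → coefficient u) ⟩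
        ∑ (suc n) (λ u → + ((j ℕ.+ u) C j) * (+ (n C (j ℕ.+ u)) * S (j ℕ.+ u)))
          ∎
    dividesWeightedSums-C^ (suc t) j = subst (q ∣_)
      (weightedSum-cong n j {λ k → + (n C k) * ((+ (n C k)) ^ suc t * monomial n a b k)}
        (λ k → sym (*-assoc (+ (n C k)) ((+ (n C k)) ^ suc t) (monomial n a b k))))
      (divides-C* q n {λ k → (+ (n C k)) ^ suc t * monomial n a b k} (dividesWeightedSums-C^ t) j)

    -- The case j = 0: the weight `W n 0 k` is itself one factor C(n, k), and the other t + 1 come
    -- from `dividesWeightedSums-C^`.
    q∣B : ∀ t → q ∣ B n (suc (suc t)) a b
    q∣B t = subst (q ∣_) (∑-cong (suc n) (λ k _ → term k)) (dividesWeightedSums-C^ t 0)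
      where
      shuffle : ∀ c x y z → c * (x * (y * z)) ≡ c * x * y * z
      shuffle = solve-∀
      W-0 : ∀ k → W n 0 k ≡ n C k
      W-0 k = trans (cong (ℕ._* (n C k)) (nC0≡1 k)) (ℕ.*-identityˡ (n C k))
      term : ∀ k → + W n 0 k * ((+ (n C k)) ^ suc t * monomial n a b k) ≡
                   (+ (n C k)) ^ suc (suc t) * a ^ (n ∸ k) * b ^ k
      term k = trans (cong (λ x → + x * ((+ (n C k)) ^ suc t * monomial n a b k)) (W-0 k))
                     (shuffle (+ (n C k)) ((+ (n C k)) ^ suc t) (a ^ (n ∸ k)) (b ^ k))

  -- From divisibility to multiplicities.

  1<∣i∣ : ∀ {i} → i ≢ 0ℤ → i ≢ + 1 → i ≢ -[1+ 0 ] → 1 < ∣ i ∣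
  1<∣i∣ {+ 0}           i≢0 _ _  = contradiction refl i≢0
  1<∣i∣ {+ 1}           _ i≢1 _  = contradiction refl i≢1
  1<∣i∣ {+ suc (suc _)} _ _ _    = s≤s (s≤s ℕ.z≤n)
  1<∣i∣ { -[1+ 0 ]}     _ _ i≢-1 = contradiction refl i≢-1
  1<∣i∣ { -[1+ suc _ ]} _ _ _    = s≤s (s≤s ℕ.z≤n)

  ω≥ : ∀ {x z e} → 1 < ∣ x ∣ → x ^ e ∣ z → ω x z ≥⁺ [ e ]
  ω≥ {x} {z} {e} 1<∣x∣ x^e∣z = by-cases (z ≟ 0ℤ)
    where
    by-cases : Dec (z ≡ 0ℤ) → ω x z ≥⁺ [ e ]
    by-cases (yes refl) = [ e ] ≤⊤⁺
    by-cases (no z≢0) with f , ω≡f , _ , f-max ← ω-finite {x} {z} 1<∣x∣ z≢0 =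
      subst (_≥⁺ [ e ]) (sym ω≡f) [ f-max e x^e∣z ]≤

  -- With `∣-signed`, passes between powers of a + b and powers of its absolute value, to which the
  -- results on natural numbers apply.
  ∣-unsigned : ∀ {x} e {m} → x ^ e ∣ + m → ∣ x ∣ ℕ.^ e ℕ.∣ m
  ∣-unsigned {x} e {m} x^e∣m = subst (ℕ._∣ m) (∣i^n∣≡∣i∣^n x e) (∣⇒∣ᵤ x^e∣m)

  ∣-signed : ∀ {x} e d {t} → ∣ x ∣ ℕ.^ e ℕ.∣ ∣ x ∣ ℕ.^ d ℕ.* t → x ^ e ∣ x ^ d * + t
  ∣-signed {x} e d {t} x^e∣x^dt = ∣ᵤ⇒∣ (subst₂ ℕ._∣_ (sym (∣i^n∣≡∣i∣^n x e))
    (sym (trans (abs-* (x ^ d) (+ t)) (cong (ℕ._* t) (∣i^n∣≡∣i∣^n x d)))) x^e∣x^dt)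

  module _ (n t : ℕ) (a b : ℤ) (1<∣a+b∣ : 1 < ∣ a + b ∣) where

    private instance
      ∣a+b∣≢0 : ℕ.NonZero ∣ a + b ∣
      ∣a+b∣≢0 = ℕ.>-nonZero (ℕ.<-trans ℕ.z<s 1<∣a+b∣)

      central≢0 : ℕ.NonZero ((n ℕ.+ n) C n)
      central≢0 = k≤n⇒nCk≢0 (ℕ.m≤m+n n n)

    private
      +≢0 : ∀ {k} .{{_ : ℕ.NonZero k}} → + k ≢ 0ℤ
      +≢0 {k} k≡0 = ℕ.≢-nonZero⁻¹ k (+-injective k≡0)

    -- The binomial coefficient is non-zero, so its multiplicity is a genuine exponent `e`. Then q^e
    -- divides every (a + b)^d γ, and hence the sum `B`.
    ω-B-even : ω (a + b) (B (n ℕ.+ n) (suc (suc t)) a b) ≥⁺ ω (a + b) (+ ((n ℕ.+ n) C n))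
    ω-B-even with e , ω≡e , q^e∣M , _ ← ω-finite {a + b} {+ ((n ℕ.+ n) C n)} 1<∣a+b∣ +≢0 =
      subst (ω (a + b) (B (n ℕ.+ n) (suc (suc t)) a b) ≥⁺_) (sym ω≡e)
        (ω≥ 1<∣a+b∣ (q∣B ((a + b) ^ e) (n ℕ.+ n) a b
          (λ s d 2s+d≡2n → ∣-signed e d (γ-even-∣ ∣ a + b ∣ e n (∣-unsigned e q^e∣M) s d 2s+d≡2n)) t))

    ω-B-odd : ω (a + b) (B (suc (n ℕ.+ n)) (suc (suc t)) a b) ≥⁺
              1+⁺ ω (a + b) (+ (suc (n ℕ.+ n) ℕ.* ((n ℕ.+ n) C n)))
    ω-B-odd with e , ω≡e , q^e∣M , _ ← ω-finite {a + b} {+ (suc (n ℕ.+ n) ℕ.* ((n ℕ.+ n) C n))} 1<∣a+b∣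
                                         (+≢0 {{ℕ.m*n≢0 (suc (n ℕ.+ n)) ((n ℕ.+ n) C n)}}) =
      subst (λ v → ω (a + b) (B (suc (n ℕ.+ n)) (suc (suc t)) a b) ≥⁺ 1+⁺ v) (sym ω≡e)
        (ω≥ 1<∣a+b∣ (q∣B ((a + b) ^ suc e) (suc (n ℕ.+ n)) a b
          (λ s d 2s+d≡2n → ∣-signed (suc e) d (γ-odd-∣ ∣ a + b ∣ e n (∣-unsigned e q^e∣M) s d 2s+d≡2n)) t))

-- The result, rewritten from n + n to 2 n.

open import Data.Integer.Base using (ℤ; +_; 0ℤ; 1ℤ; -1ℤ; _+_)
open import Data.Integer.GCD using (gcd)
open import Data.Nat.Base as ℕ using (ℕ; _*_; _>_)
open import Data.Nat.Combinatorics using (_C_)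
open import Data.Nat.Properties using (+-identityʳ)
open import Data.Product.Base using (_×_; _,_)
open import Relation.Binary.PropositionalEquality using (_≡_; _≢_; sym; cong; subst)
open import Defs
open Integers using (1<∣i∣; ω-B-even; ω-B-odd)

theorem2 : (n : ℕ) (a b : ℤ) → gcd a b ≡ 1ℤ →
    a + b ≢ 0ℤ → a + b ≢ 1ℤ → a + b ≢ -1ℤ →
    (m : ℕ) → m > 2 →
    (ω (a + b) (B (2 * n) m a b) ≥⁺ ω (a + b) (+ ((2 * n) C n)))
    × (ω (a + b) (B (1 ℕ.+ 2 * n) m a b) ≥⁺ 1+⁺ ω (a + b) (+ ((1 ℕ.+ 2 * n) * ((2 * n) C n))))
theorem2 n a b _ q≢0 q≢1 q≢-1 (ℕ.suc (ℕ.suc t)) _ =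
    subst (λ N → ω (a + b) (B N (2 ℕ.+ t) a b) ≥⁺ ω (a + b) (+ (N C n))) n+n≡2n
      (ω-B-even n t a b 1<∣a+b∣)
  , subst (λ N → ω (a + b) (B (1 ℕ.+ N) (2 ℕ.+ t) a b) ≥⁺ 1+⁺ ω (a + b) (+ ((1 ℕ.+ N) * (N C n)))) n+n≡2n
      (ω-B-odd n t a b 1<∣a+b∣)
  where
  1<∣a+b∣ = 1<∣i∣ q≢0 q≢1 q≢-1
  n+n≡2n : n ℕ.+ n ≡ 2 * n
  n+n≡2n = cong (n ℕ.+_) (sym (+-identityʳ n))
theorem2 _ _ _ _ _ _ _ (ℕ.suc ℕ.zero) (ℕ.s≤s ())
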